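{- Let $\mathbb{F}_q$ be a finite field with $q$ elements, let $P(X,Z)\in\mathbb{F}_q[X,Z]$ be monic in $Z$ with $\deg_Z P\ge 2$, and let $Q(X,Y,Z)\in\mathbb{F}_q[X,Y,Z]$ be monic in $Y$ with $\deg_Y Q\ge 2$. Let $\chi_1$ be a fixed nontrivial additive character of $\mathbb{F}_q$, and let $$N_0'=\#\{(\beta,\gamma)\in\mathbb{F}_q^2\mid P(0,\gamma)=0,\ Q(0,\beta,\gamma)=0\}.$$ If $P(0,Z)$ has $r$ distinct roots in $\mathbb{F}_q$, then $$N_0'=r+\frac{1}{q}\sum_{\substack{\gamma\in\mathbb{F}_q\\ P(0,\gamma)=0}}\ \sum_{s\in\mathbb{F}_q^\times}\ \sum_{\beta\in\mathbb{F}_q}\chi_1\bigl(s\,Q(0,\beta,\gamma)\bigr).$$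
   Context: An additive character of $\mathbb{F}_q$ is a group homomorphism from $(\mathbb{F}_q,+)$ to the complex numbers of absolute value $1$; it is nontrivial if it is not identically $1$. "Monic in $Z$" means leading coefficient $1$ as a polynomial in $Z$ over the polynomial ring in the other variables; similarly for $Y$. $\mathbb{F}_q^\times=\mathbb{F}_q\setminus\{0\}$. -}

module Defs where

open import Algebra.Bundles using (CommutativeRing)
open import Algebra.Bundles.Raw using (RawRing)
import Algebra.Definitions.RawSemiring as RawSemiringDefinitions
open import Algebra.Morphism.Structures using (IsMonoidHomomorphism)
open import Data.Fin.Base using (Fin)
import Data.Fin.Properties as Fin
open import Data.Integer.Base using (+_)
open import Data.List.Base using (List; []; _∷_; [_]; allFin; cartesianProduct; filter; foldr; length; map)
open import Data.Nat.Base as ℕ using (ℕ; zero; suc)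
import Data.Nat.Properties as ℕ
open import Data.Product.Base using (∃-syntax; _×_; _,_; proj₁; proj₂; map₂)
open import Data.Rational.Base as ℚ using (ℚ; 0ℚ; 1ℚ; ½; ∣_∣)
import Data.Rational.Properties as ℚ
open import Data.Rational.Solver using (module +-*-Solver)
open import Data.Vec.Base using (Vec; []; _∷_; lookup; removeAt; replicate)
import Data.Vec.Properties as Vec
open import Function.Bundles using (Inverse)
open import Level using (Level; 0ℓ; _⊔_) renaming (suc to lsuc)
open import Relation.Binary.Definitions using (Decidable)
open import Relation.Binary.PropositionalEquality as ≡ using (_≡_)
open import Relation.Nullary.Decidable using (map′; ¬?; _×-dec_)
open import Relation.Nullary.Negation using (¬_)
open import Relation.Unary using (Pred) renaming (Decidable to Decidable₁)

-- The reals are Cauchy sequences of rationals equipped with a modulus of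
-- convergence, up to the setoid equality _≈ᴿ_.

Cauchy : (ℕ → ℚ) → Set
Cauchy x = ∀ ε → 0ℚ ℚ.< ε →
  ∃[ N ] (∀ m n → N ℕ.≤ m → N ℕ.≤ n → ∣ x m ℚ.- x n ∣ ℚ.< ε)

record ℝ : Set where
  constructor mkℝ
  field
    seq    : ℕ → ℚ
    cauchy : Cauchy seq

open ℝ public

infix 4 _≈ᴿ_ _≤ᴿ_

_≈ᴿ_ : ℝ → ℝ → Set
x ≈ᴿ y = ∀ ε → 0ℚ ℚ.< ε →
  ∃[ N ] (∀ n → N ℕ.≤ n → ∣ seq x n ℚ.- seq y n ∣ ℚ.< ε)

_≤ᴿ_ : ℝ → ℝ → Set
x ≤ᴿ y = ∀ ε → 0ℚ ℚ.< ε →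
  ∃[ N ] (∀ n → N ℕ.≤ n → seq x n ℚ.< seq y n ℚ.+ ε)

fromℚ : ℚ → ℝ
fromℚ p = mkℝ (λ _ → p) λ ε 0<ε → 0 , λ _ _ _ _ →
  ≡.subst (ℚ._< ε) (≡.sym (≡.cong ∣_∣ (ℚ.+-inverseʳ p))) 0<ε

0ᴿ 1ᴿ : ℝ
0ᴿ = fromℚ 0ℚ
1ᴿ = fromℚ 1ℚ

private
  module _ (ε : ℚ) (0<ε : 0ℚ ℚ.< ε) where

    half : ℚ
    half = ½ ℚ.* ε

    0<half : 0ℚ ℚ.< half
    0<half = ≡.subst (ℚ._< half) (ℚ.*-zeroʳ ½) (ℚ.*-monoʳ-<-pos ½ 0<ε)

    half+half : half ℚ.+ half ≡ ε
    half+half = ≡.trans (≡.sym (ℚ.*-distribʳ-+ ε ½ ½)) (ℚ.*-identityˡ ε)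

+-cauchy : ∀ x y → Cauchy x → Cauchy y → Cauchy (λ n → x n ℚ.+ y n)
+-cauchy x y cx cy ε 0<ε
  with M , hx ← cx (half ε 0<ε) (0<half ε 0<ε)
     | N , hy ← cy (half ε 0<ε) (0<half ε 0<ε)
  = M ℕ.⊔ N , λ m n ≤m ≤n → begin-strict
      ∣ x m ℚ.+ y m ℚ.- (x n ℚ.+ y n) ∣
        ≡⟨ ≡.cong ∣_∣ (rearrange (x m) (y m) (x n) (y n)) ⟩
      ∣ (x m ℚ.- x n) ℚ.+ (y m ℚ.- y n) ∣
        ≤⟨ ℚ.∣p+q∣≤∣p∣+∣q∣ (x m ℚ.- x n) (y m ℚ.- y n) ⟩
      ∣ x m ℚ.- x n ∣ ℚ.+ ∣ y m ℚ.- y n ∣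
        <⟨ ℚ.+-mono-< (hx m n (ℕ.m⊔n≤o⇒m≤o M N ≤m) (ℕ.m⊔n≤o⇒m≤o M N ≤n))
                      (hy m n (ℕ.m⊔n≤o⇒n≤o M N ≤m) (ℕ.m⊔n≤o⇒n≤o M N ≤n)) ⟩
      half ε 0<ε ℚ.+ half ε 0<ε
        ≡⟨ half+half ε 0<ε ⟩
      ε ∎
  where
  open ℚ.≤-Reasoning
  open +-*-Solver
  rearrange : ∀ a b c d → a ℚ.+ b ℚ.- (c ℚ.+ d) ≡ (a ℚ.- c) ℚ.+ (b ℚ.- d)
  rearrange = solve 4 (λ a b c d →
    (a :+ b) :- (c :+ d) := (a :- c) :+ (b :- d)) ≡.refl

neg-cauchy : ∀ x → Cauchy x → Cauchy (λ n → ℚ.- x n)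
neg-cauchy x cx ε 0<ε with N , hx ← cx ε 0<ε =
  N , λ m n ≤m ≤n → ≡.subst (ℚ._< ε) (flip (x m) (x n)) (hx m n ≤m ≤n)
  where
  open +-*-Solver
  flip : ∀ a b → ∣ a ℚ.- b ∣ ≡ ∣ ℚ.- a ℚ.- ℚ.- b ∣
  flip a b = ≡.trans (≡.sym (ℚ.∣-p∣≡∣p∣ (a ℚ.- b)))
    (≡.cong ∣_∣ (solve 2 (λ a b → :- (a :- b) := :- a :- :- b) ≡.refl a b))

cauchy-bounded : ∀ x → Cauchy x →
  ∃[ B ] 0ℚ ℚ.< B × ∃[ N ] (∀ n → N ℕ.≤ n → ∣ x n ∣ ℚ.≤ B)
cauchy-bounded x cx with N , hx ← cx 1ℚ (ℚ.positive⁻¹ 1ℚ) =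
  ∣ x N ∣ ℚ.+ 1ℚ ,
  ℚ.+-mono-≤-< (ℚ.0≤∣p∣ (x N)) (ℚ.positive⁻¹ 1ℚ) ,
  N , λ n ≤n → begin
    ∣ x n ∣                        ≡⟨ ≡.cong ∣_∣ (split (x n) (x N)) ⟩
    ∣ x N ℚ.+ (x n ℚ.- x N) ∣      ≤⟨ ℚ.∣p+q∣≤∣p∣+∣q∣ (x N) (x n ℚ.- x N) ⟩
    ∣ x N ∣ ℚ.+ ∣ x n ℚ.- x N ∣    ≤⟨ ℚ.+-monoʳ-≤ ∣ x N ∣ (ℚ.<⇒≤ (hx n N ≤n ℕ.≤-refl)) ⟩
    ∣ x N ∣ ℚ.+ 1ℚ                 ∎
  where
  open ℚ.≤-Reasoning
  open +-*-Solver
  split : ∀ a b → a ≡ b ℚ.+ (a ℚ.- b)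
  split = solve 2 (λ a b → a := b :+ (a :- b)) ≡.refl

module _ (B : ℚ) (0<B : 0ℚ ℚ.< B) (ε : ℚ) (0<ε : 0ℚ ℚ.< ε) where
  open ℚ.≤-Reasoning
  open +-*-Solver

  private
    instance
      B-pos : ℚ.Positive B
      B-pos = ℚ.positive 0<B

      B-nonZero : ℚ.NonZero B
      B-nonZero = ℚ.pos⇒nonZero B

      1/B-pos : ℚ.Positive (ℚ.1/ B)
      1/B-pos = ℚ.1/pos⇒pos B

    δ : ℚ
    δ = ℚ.1/ B ℚ.* half ε 0<ε

    0<δ : 0ℚ ℚ.< δ
    0<δ = ≡.subst (ℚ._< δ) (ℚ.*-zeroʳ (ℚ.1/ B)) (ℚ.*-monoʳ-<-pos (ℚ.1/ B) (0<half ε 0<ε))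

    B*δ : B ℚ.* δ ≡ half ε 0<ε
    B*δ = ≡.trans (≡.sym (ℚ.*-assoc B (ℚ.1/ B) (half ε 0<ε)))
            (≡.trans (≡.cong (ℚ._* half ε 0<ε) (ℚ.*-inverseʳ B)) (ℚ.*-identityˡ _))

    rearrange : ∀ a b c d → a ℚ.* b ℚ.- c ℚ.* d ≡ a ℚ.* (b ℚ.- d) ℚ.+ d ℚ.* (a ℚ.- c)
    rearrange = solve 4 (λ a b c d →
      (a :* b) :- (c :* d) := (a :* (b :- d)) :+ (d :* (a :- c))) ≡.refl

    bound : ∀ p r → ∣ p ∣ ℚ.≤ B → ∣ r ∣ ℚ.< δ → ∣ p ℚ.* r ∣ ℚ.< half ε 0<ε
    bound p r p≤B r<δ = begin-strict
      ∣ p ℚ.* r ∣      ≡⟨ ℚ.∣p*q∣≡∣p∣*∣q∣ p r ⟩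
      ∣ p ∣ ℚ.* ∣ r ∣  ≤⟨ ℚ.*-monoʳ-≤-nonNeg ∣ r ∣ {{ℚ.∣-∣-nonNeg r}} p≤B ⟩
      B ℚ.* ∣ r ∣      <⟨ ℚ.*-monoʳ-<-pos B r<δ ⟩
      B ℚ.* δ          ≡⟨ B*δ ⟩
      half ε 0<ε       ∎

  *-close : ∃[ η ] 0ℚ ℚ.< η × (∀ a b c d → ∣ a ∣ ℚ.≤ B → ∣ d ∣ ℚ.≤ B →
    ∣ a ℚ.- c ∣ ℚ.< η → ∣ b ℚ.- d ∣ ℚ.< η → ∣ a ℚ.* b ℚ.- c ℚ.* d ∣ ℚ.< ε)
  *-close = δ , 0<δ , λ a b c d a≤B d≤B a-c<δ b-d<δ → begin-strict
    ∣ a ℚ.* b ℚ.- c ℚ.* d ∣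
      ≡⟨ ≡.cong ∣_∣ (rearrange a b c d) ⟩
    ∣ a ℚ.* (b ℚ.- d) ℚ.+ d ℚ.* (a ℚ.- c) ∣
      ≤⟨ ℚ.∣p+q∣≤∣p∣+∣q∣ (a ℚ.* (b ℚ.- d)) (d ℚ.* (a ℚ.- c)) ⟩
    ∣ a ℚ.* (b ℚ.- d) ∣ ℚ.+ ∣ d ℚ.* (a ℚ.- c) ∣
      <⟨ ℚ.+-mono-< (bound a (b ℚ.- d) a≤B b-d<δ) (bound d (a ℚ.- c) d≤B a-c<δ) ⟩
    half ε 0<ε ℚ.+ half ε 0<ε
      ≡⟨ half+half ε 0<ε ⟩
    ε ∎

-- Written with projections because with-abstraction normalises the goal,
-- which is prohibitively slow for rational arithmetic.
*-cauchy : ∀ x y → Cauchy x → Cauchy y → Cauchy (λ n → x n ℚ.* y n)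
*-cauchy x y cx cy ε 0<ε = K ℕ.⊔ L , λ m n ≤m ≤n →
  let
    Km = ℕ.m⊔n≤o⇒m≤o K L ≤m
    Kn = ℕ.m⊔n≤o⇒m≤o K L ≤n
    Lm = ℕ.m⊔n≤o⇒n≤o K L ≤m
    Ln = ℕ.m⊔n≤o⇒n≤o K L ≤n
  in proj₂ (proj₂ close) (x m) (y m) (x n) (y n)
       (ℚ.≤-trans (proj₂ (proj₂ (proj₂ bx)) m (ℕ.m⊔n≤o⇒m≤o Kx Ky Km)) (ℚ.p≤p⊔q Bx By))
       (ℚ.≤-trans (proj₂ (proj₂ (proj₂ by)) n (ℕ.m⊔n≤o⇒n≤o Kx Ky Kn)) (ℚ.p≤q⊔p Bx By))
       (proj₂ hx m n (ℕ.m⊔n≤o⇒m≤o Lx Ly Lm) (ℕ.m⊔n≤o⇒m≤o Lx Ly Ln))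
       (proj₂ hy m n (ℕ.m⊔n≤o⇒n≤o Lx Ly Lm) (ℕ.m⊔n≤o⇒n≤o Lx Ly Ln))
  where
  bx = cauchy-bounded x cx
  by = cauchy-bounded y cy
  Bx = proj₁ bx
  By = proj₁ by
  Kx = proj₁ (proj₂ (proj₂ bx))
  Ky = proj₁ (proj₂ (proj₂ by))
  close = *-close (Bx ℚ.⊔ By) (ℚ.<-≤-trans (proj₁ (proj₂ bx)) (ℚ.p≤p⊔q Bx By)) ε 0<ε
  hx = cx (proj₁ close) (proj₁ (proj₂ close))
  hy = cy (proj₁ close) (proj₁ (proj₂ close))
  Lx = proj₁ hx
  Ly = proj₁ hy
  K = Kx ℕ.⊔ Ky
  L = Lx ℕ.⊔ Ly

infixl 6 _+ᴿ_
infixl 7 _*ᴿ_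
infix  8 -ᴿ_

_+ᴿ_ _*ᴿ_ : ℝ → ℝ → ℝ
x +ᴿ y = mkℝ (λ n → seq x n ℚ.+ seq y n) (+-cauchy (seq x) (seq y) (cauchy x) (cauchy y))
x *ᴿ y = mkℝ (λ n → seq x n ℚ.* seq y n) (*-cauchy (seq x) (seq y) (cauchy x) (cauchy y))

-ᴿ_ : ℝ → ℝ
-ᴿ x = mkℝ (λ n → ℚ.- seq x n) (neg-cauchy (seq x) (cauchy x))

infix 4 _≈ᶜ_
infixl 6 _+ᶜ_
infixl 7 _*ᶜ_
infix  8 -ᶜ_

record ℂ : Set where
  constructor _+i_
  field
    re im : ℝ

open ℂ public

_≈ᶜ_ : ℂ → ℂ → Set
z ≈ᶜ w = re z ≈ᴿ re w × im z ≈ᴿ im w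

_+ᶜ_ _*ᶜ_ : ℂ → ℂ → ℂ
z +ᶜ w = (re z +ᴿ re w) +i (im z +ᴿ im w)
z *ᶜ w = (re z *ᴿ re w +ᴿ -ᴿ (im z *ᴿ im w)) +i (re z *ᴿ im w +ᴿ im z *ᴿ re w)

-ᶜ_ : ℂ → ℂ
-ᶜ z = (-ᴿ re z) +i (-ᴿ im z)

ℚ⇒ℂ : ℚ → ℂ
ℚ⇒ℂ p = fromℚ p +i 0ᴿ

ℕ⇒ℂ : ℕ → ℂ
ℕ⇒ℂ n = ℚ⇒ℂ (+ n ℚ./ 1)

ℂ-rawRing : RawRing 0ℓ 0ℓ
ℂ-rawRing = record
  { Carrier = ℂ
  ; _≈_     = _≈ᶜ_
  ; _+_     = _+ᶜ_
  ; _*_     = _*ᶜ_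
  ; -_      = -ᶜ_
  ; 0#      = ℚ⇒ℂ 0ℚ
  ; 1#      = ℚ⇒ℂ 1ℚ
  }

-- |z| = r, i.e. r is the nonnegative square root of (re z)² + (im z)².
HasAbsoluteValue : ℂ → ℝ → Set
HasAbsoluteValue z r =
  0ᴿ ≤ᴿ r × r *ᴿ r ≈ᴿ re z *ᴿ re z +ᴿ im z *ᴿ im z

∑ : ∀ {a} {A : Set a} → List A → (A → ℂ) → ℂ
∑ xs f = foldr (λ x s → f x +ᶜ s) (ℚ⇒ℂ 0ℚ) xs

-- The enumeration is a setoid isomorphism, so it lists every element of
-- the field, up to _≈_, exactly once.
record FiniteField (c ℓ : Level) (q : ℕ) : Set (lsuc (c ⊔ ℓ)) where
  field
    commutativeRing : CommutativeRing c ℓ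

  open CommutativeRing commutativeRing public

  field
    1≉0         : ¬ 1# ≈ 0#
    inverse     : ∀ x → ¬ x ≈ 0# → ∃[ y ] x * y ≈ 1#
    enumeration : Inverse (≡.setoid (Fin q)) setoid

  private module E = Inverse enumeration

  infix 4 _≟_
  _≟_ : Decidable _≈_
  x ≟ y = map′
    (λ eq → trans (sym (E.strictlyInverseˡ x)) (trans (E.to-cong eq) (E.strictlyInverseˡ y)))
    E.from-cong
    (E.from x Fin.≟ E.from y)

  elements : List Carrier
  elements = map E.to (allFin q)

  order-nonZero : ℕ.NonZero q
  order-nonZero = Fin.nonZeroIndex (E.from 0#)

  1/order : ℂ
  1/order = ℚ⇒ℂ ((+ 1 ℚ./ q) {{order-nonZero}})

# : ∀ {a p} {A : Set a} {P : Pred A p} → Decidable₁ P → List A → ℕ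
# P? xs = length (filter P? xs)

module OverFiniteField {c ℓ : Level} {q : ℕ} (F : FiniteField c ℓ q) where
  open FiniteField F
  open RawSemiringDefinitions (RawRing.rawSemiring rawRing) using (_^_)

  -- A polynomial in n variables, as a formal sum of terms.  A monomial may
  -- occur in several terms; its coefficient is the sum over all of them.
  Polynomial : ℕ → Set c
  Polynomial n = List (Carrier × Vec ℕ n)

  coefficient : ∀ {n} → Polynomial n → Vec ℕ n → Carrier
  coefficient p e =
    foldr (λ t s → proj₁ t + s) 0# (filter (λ t → Vec.≡-dec ℕ._≟_ (proj₂ t) e) p)

  infix 4 _≈ₚ_
  _≈ₚ_ : ∀ {n} → Polynomial n → Polynomial n → Set ℓ
  p ≈ₚ p′ = ∀ e → coefficient p e ≈ coefficient p′ e

  0ₚ 1ₚ : ∀ {n} → Polynomial n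
  0ₚ = []
  1ₚ = [ 1# , replicate _ 0 ]

  monomial : ∀ {n} → Vec Carrier n → Vec ℕ n → Carrier
  monomial []       []       = 1#
  monomial (x ∷ xs) (k ∷ ks) = x ^ k * monomial xs ks

  eval : ∀ {n} → Polynomial n → Vec Carrier n → Carrier
  eval p xs = foldr (λ t s → proj₁ t * monomial xs (proj₂ t) + s) 0# p

  -- The coefficient of the d-th power of variable i, as a polynomial in the
  -- remaining variables.
  coefficientIn : ∀ {n} → Fin (suc n) → ℕ → Polynomial (suc n) → Polynomial n
  coefficientIn i d p =
    map (map₂ (λ e → removeAt e i)) (filter (λ t → lookup (proj₂ t) i ℕ.≟ d) p)

  HasDegreeIn : ∀ {n} → Fin (suc n) → Polynomial (suc n) → ℕ → Set ℓ
  HasDegreeIn i p d =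
    ¬ coefficientIn i d p ≈ₚ 0ₚ × (∀ k → d ℕ.< k → coefficientIn i k p ≈ₚ 0ₚ)

  MonicIn : ∀ {n} → Fin (suc n) → Polynomial (suc n) → Set ℓ
  MonicIn i p = ∃[ d ] HasDegreeIn i p d × coefficientIn i d p ≈ₚ 1ₚ

  elements× : List Carrier
  elements× = filter (λ s → ¬? (s ≟ 0#)) elements

  -- A map of groups that preserves the identity and the operation also
  -- preserves inverses, so a monoid homomorphism is a group homomorphism here.
  record AdditiveCharacter : Set (c ⊔ ℓ) where
    field
      χ              : Carrier → ℂ
      isHomomorphism : IsMonoidHomomorphism
                         (RawRing.+-rawMonoid rawRing) (RawRing.*-rawMonoid ℂ-rawRing) χ
      unitModulus    : ∀ x → HasAbsoluteValue (χ x) 1ᴿ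

  Nontrivial : AdditiveCharacter → Set c
  Nontrivial ψ = ¬ (∀ x → AdditiveCharacter.χ ψ x ≈ᶜ ℚ⇒ℂ 1ℚ)

  -- The variables are ordered X, Z for P and X, Y, Z for Q; hence index 1 is
  -- Z for P and Y for Q.
  module _ (P : Polynomial 2) where

    P₀-root? : Decidable₁ (λ γ → eval P (0# ∷ γ ∷ []) ≈ 0#)
    P₀-root? γ = eval P (0# ∷ γ ∷ []) ≟ 0#

    P₀-roots : List Carrier
    P₀-roots = filter P₀-root? elements

    N₀′ : Polynomial 3 → ℕ
    N₀′ Q = # {P = λ (β , γ) → eval P (0# ∷ γ ∷ []) ≈ 0# × eval Q (0# ∷ β ∷ γ ∷ []) ≈ 0#}
              (λ (β , γ) → P₀-root? γ ×-dec (eval Q (0# ∷ β ∷ γ ∷ []) ≟ 0#))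
              (cartesianProduct elements elements)

{-# OPTIONS --safe #-}
-- Orthogonality of characters: for fixed y ≠ 0 put T = Σ_s χ₁(s y), the sum
-- over all s. Substituting s + a y⁻¹ for s gives χ₁(a) T = T for every a, so
-- T = 0 as χ₁ is nontrivial, while for y = 0 the sum is q. Hence, for a fixed
-- root γ of P(0,Z), q times the number of β with Q(0,β,γ) = 0 is
-- Σ_β Σ_s χ₁(s Q(0,β,γ)), whose terms with s = 0 contribute q. Divide by q and
-- add up over the r roots.
module Submission where

open import Algebra.Bundles using (CommutativeRing)
open import Algebra.Morphism.Structures using (IsMonoidHomomorphism)
open import Algebra.Structures using (IsCommutativeRing)
open import Data.Bool.Base using (true; false; if_then_else_)
open import Data.Fin.Base using (Fin; zero; suc)
open import Data.Fin.Patterns using (1F)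
open import Data.Fin.Permutation using (Permutation′; permutation)
import Data.Fin.Properties as Fin
open import Data.Integer.Base as ℤ using (+_)
import Data.Integer.Properties as ℤ
open import Data.List.Base
  using (List; []; _∷_; _++_; allFin; cartesianProduct; filter; foldr; length; map; tabulate)
import Data.List.Properties as List
open import Data.Nat.Base as ℕ using (ℕ; suc; _≤_)
import Data.Nat.Properties as ℕ
open import Data.Product.Base as Product using (_,_; ∃-syntax; proj₁; proj₂)
open import Data.Rational.Base as ℚ using (ℚ; 0ℚ; 1ℚ; ½; ∣_∣)
import Data.Rational.Properties as ℚ
open import Data.Rational.Solver using (module +-*-Solver)
import Data.Rational.Unnormalised.Base as ℚᵘ
import Data.Rational.Unnormalised.Properties as ℚᵘ
open import Data.Sum.Base using (inj₁; inj₂; [_,_]′)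
open import Data.Vec.Base using ([]; _∷_)
open import Function.Base using (_∘_; const; id)
open import Function.Bundles using (Inverse)
open import Level using (Level; 0ℓ)
open import Relation.Binary.PropositionalEquality as ≡ using (_≡_)
import Relation.Binary.Reasoning.Setoid as ≈-Reasoning
open import Relation.Nullary.Decidable as Dec using (Dec; does; yes; no; ¬?; _×-dec_)
open import Relation.Nullary.Negation using (¬_; contradiction)
open import Relation.Unary using (Pred) renaming (Decidable to Decidable₁)
open import Defs

module Summation {a ℓ} (R : CommutativeRing a ℓ) where
  open CommutativeRing R hiding (zero)
  open ≈-Reasoning setoid
  open import Algebra.Definitions.RawMonoid +-rawMonoid using (_×_; sum)
  open import Algebra.Properties.CommutativeMonoid.Sum +-commutativeMonoid
    using (sum-cong-≋; sum-replicate-zero)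
  open import Algebra.Properties.CommutativeSemigroup +-commutativeSemigroup
    using (interchange)

  sumOver : ∀ {b} {B : Set b} → List B → (B → Carrier) → Carrier
  sumOver xs f = foldr (λ x s → f x + s) 0# xs

  𝟙 : ∀ {p} {P : Set p} → Dec P → Carrier
  𝟙 d = if does d then 1# else 0#

  𝟙-yes : ∀ {p} {P : Set p} (d : Dec P) → P → 𝟙 d ≈ 1#
  𝟙-yes (yes _) _ = refl
  𝟙-yes (no ¬p) p = contradiction p ¬p

  𝟙-no : ∀ {p} {P : Set p} (d : Dec P) → ¬ P → 𝟙 d ≈ 0#
  𝟙-no (yes p) ¬p = contradiction p ¬p
  𝟙-no (no _)  _  = refl

  𝟙-×-dec : ∀ {p r} {P : Set p} {R : Set r} (d : Dec P) (e : Dec R) →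
            𝟙 (d ×-dec e) ≈ 𝟙 d * 𝟙 e
  𝟙-×-dec d e with does d
  ... | true  = sym (*-identityˡ _)
  ... | false = sym (zeroˡ _)

  𝟙-split : ∀ {p} {P : Set p} (d : Dec P) x → x ≈ 𝟙 d * x + 𝟙 (¬? d) * x
  𝟙-split d x with does d
  ... | true  = sym (trans (+-cong (*-identityˡ x) (zeroˡ x)) (+-identityʳ x))
  ... | false = sym (trans (+-cong (zeroˡ x) (*-identityˡ x)) (+-identityˡ x))

  module _ {b} {B : Set b} where

    sumOver-cong : ∀ xs {f g : B → Carrier} → (∀ x → f x ≈ g x) → sumOver xs f ≈ sumOver xs g
    sumOver-cong []       f≈g = refl
    sumOver-cong (x ∷ xs) f≈g = +-cong (f≈g x) (sumOver-cong xs f≈g)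

    sumOver-0 : ∀ (xs : List B) → sumOver xs (const 0#) ≈ 0#
    sumOver-0 []       = refl
    sumOver-0 (x ∷ xs) = trans (+-identityˡ _) (sumOver-0 xs)

    sumOver-1 : ∀ (xs : List B) → sumOver xs (const 1#) ≈ length xs × 1#
    sumOver-1 []       = refl
    sumOver-1 (x ∷ xs) = +-congˡ (sumOver-1 xs)

    sumOver-+ : ∀ xs (f g : B → Carrier) →
                sumOver xs (λ x → f x + g x) ≈ sumOver xs f + sumOver xs g
    sumOver-+ []       f g = sym (+-identityˡ 0#)
    sumOver-+ (x ∷ xs) f g = trans (+-congˡ (sumOver-+ xs f g)) (interchange _ _ _ _)

    *-distribˡ-sumOver : ∀ xs y (f : B → Carrier) →
                         y * sumOver xs f ≈ sumOver xs (λ x → y * f x)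
    *-distribˡ-sumOver []       y f = zeroʳ y
    *-distribˡ-sumOver (x ∷ xs) y f =
      trans (distribˡ y _ _) (+-congˡ (*-distribˡ-sumOver xs y f))

    sumOver-++ : ∀ xs ys (f : B → Carrier) → sumOver (xs ++ ys) f ≈ sumOver xs f + sumOver ys f
    sumOver-++ []       ys f = sym (+-identityˡ _)
    sumOver-++ (x ∷ xs) ys f = trans (+-congˡ (sumOver-++ xs ys f)) (sym (+-assoc _ _ _))

    sumOver-map : ∀ {d} {D : Set d} (g : D → B) xs (f : B → Carrier) →
                  sumOver (map g xs) f ≈ sumOver xs (f ∘ g)
    sumOver-map g []       f = refl
    sumOver-map g (x ∷ xs) f = +-congˡ (sumOver-map g xs f)

    sumOver-tabulate : ∀ {n} (g : Fin n → B) f → sumOver (tabulate g) f ≈ sum (f ∘ g)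
    sumOver-tabulate {ℕ.zero} g f = refl
    sumOver-tabulate {suc n}  g f = +-congˡ (sumOver-tabulate (g ∘ suc) f)

    sumOver-filter : ∀ {p} {P : Pred B p} (P? : Decidable₁ P) xs f →
                     sumOver (filter P? xs) f ≈ sumOver xs (λ x → 𝟙 (P? x) * f x)
    sumOver-filter P? []       f = refl
    sumOver-filter P? (x ∷ xs) f with does (P? x)
    ... | true  = +-cong (sym (*-identityˡ _)) (sumOver-filter P? xs f)
    ... | false = trans (sumOver-filter P? xs f)
                    (trans (sym (+-identityˡ _)) (+-congʳ (sym (zeroˡ _))))

    #-sumOver : ∀ {p} {P : Pred B p} (P? : Decidable₁ P) xs →
                # P? xs × 1# ≈ sumOver xs (λ x → 𝟙 (P? x))
    #-sumOver P? xs = begin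
      # P? xs × 1#                     ≈⟨ sumOver-1 (filter P? xs) ⟨
      sumOver (filter P? xs) (const 1#) ≈⟨ sumOver-filter P? xs (const 1#) ⟩
      sumOver xs (λ x → 𝟙 (P? x) * 1#)  ≈⟨ sumOver-cong xs (λ _ → *-identityʳ _) ⟩
      sumOver xs (λ x → 𝟙 (P? x))       ∎

  module _ {b d} {B : Set b} {D : Set d} where

    sumOver-comm : ∀ xs ys (f : B → D → Carrier) →
                   sumOver xs (λ x → sumOver ys (f x)) ≈ sumOver ys (λ y → sumOver xs (λ x → f x y))
    sumOver-comm []       ys f = sym (sumOver-0 ys)
    sumOver-comm (x ∷ xs) ys f = trans (+-congˡ (sumOver-comm xs ys f)) (sym (sumOver-+ ys _ _))

    sumOver-cartesianProduct : ∀ xs (ys : List D) (f : B Product.× D → Carrier) →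
      sumOver (cartesianProduct xs ys) f ≈ sumOver xs (λ x → sumOver ys (λ y → f (x , y)))
    sumOver-cartesianProduct []       ys f = refl
    sumOver-cartesianProduct (x ∷ xs) ys f =
      trans (sumOver-++ (map (x ,_) ys) _ f)
        (+-cong (sumOver-map (x ,_) ys f) (sumOver-cartesianProduct xs ys f))

    #-fibres : ∀ {p r} {P : Pred D p} {R : B → D → Set r}
      (P? : Decidable₁ P) (R? : ∀ x y → Dec (R x y)) xs ys →
      # (λ (x , y) → P? y ×-dec R? x y) (cartesianProduct xs ys) × 1#
        ≈ sumOver (filter P? ys) (λ y → sumOver xs (λ x → 𝟙 (R? x y)))
    #-fibres P? R? xs ys = begin
      # (λ (x , y) → P? y ×-dec R? x y) (cartesianProduct xs ys) × 1#
        ≈⟨ #-sumOver (λ (x , y) → P? y ×-dec R? x y) (cartesianProduct xs ys) ⟩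
      sumOver (cartesianProduct xs ys) (λ (x , y) → 𝟙 (P? y ×-dec R? x y))
        ≈⟨ sumOver-cartesianProduct xs ys _ ⟩
      sumOver xs (λ x → sumOver ys (λ y → 𝟙 (P? y ×-dec R? x y)))
        ≈⟨ sumOver-comm xs ys _ ⟩
      sumOver ys (λ y → sumOver xs (λ x → 𝟙 (P? y ×-dec R? x y)))
        ≈⟨ sumOver-cong ys (λ y → sumOver-cong xs (λ x → 𝟙-×-dec (P? y) (R? x y))) ⟩
      sumOver ys (λ y → sumOver xs (λ x → 𝟙 (P? y) * 𝟙 (R? x y)))
        ≈⟨ sumOver-cong ys (λ y → sym (*-distribˡ-sumOver xs (𝟙 (P? y)) _)) ⟩
      sumOver ys (λ y → 𝟙 (P? y) * sumOver xs (λ x → 𝟙 (R? x y)))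
        ≈⟨ sumOver-filter P? ys _ ⟨
      sumOver (filter P? ys) (λ y → sumOver xs (λ x → 𝟙 (R? x y))) ∎

  sum-single : ∀ {n} (i : Fin n) (t : Fin n → Carrier) →
               (∀ j → ¬ j ≡ i → t j ≈ 0#) → sum t ≈ t i
  sum-single {suc n} zero t t≈0 = begin
    t zero + sum (t ∘ suc)        ≈⟨ +-congˡ (sum-cong-≋ (λ j → t≈0 (suc j) (λ ()))) ⟩
    t zero + sum {n} (const 0#)   ≈⟨ +-congˡ (sum-replicate-zero n) ⟩
    t zero + 0#                   ≈⟨ +-identityʳ _ ⟩
    t zero                        ∎
  sum-single {suc n} (suc i) t t≈0 = begin
    t zero + sum (t ∘ suc)  ≈⟨ +-congʳ (t≈0 zero (λ ())) ⟩
    0# + sum (t ∘ suc)      ≈⟨ +-identityˡ _ ⟩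
    sum (t ∘ suc)           ≈⟨ sum-single i (t ∘ suc) (λ j j≢i → t≈0 (suc j) (j≢i ∘ Fin.suc-injective)) ⟩
    t (suc i)               ∎

module CharacterSums
  {c ℓ a ℓ′} {q : ℕ} (F : FiniteField c ℓ q) (R : CommutativeRing a ℓ′)
  where

  private
    module F where
      open FiniteField F public
      open OverFiniteField F public
    module E = Inverse F.enumeration

  open CommutativeRing R hiding (zero)
  open Summation R
  open ≈-Reasoning setoid
  open import Algebra.Definitions.RawMonoid +-rawMonoid using (_×_; sum)
  open import Algebra.Properties.CommutativeMonoid.Sum +-commutativeMonoid
    using (sum-cong-≋; sum-permute)

  sumOver-elements : ∀ f → sumOver F.elements f ≈ sum (f ∘ E.to)
  sumOver-elements f = trans (sumOver-map E.to (allFin q) f) (sumOver-tabulate id (f ∘ E.to))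

  sumOver-elements-1 : sumOver F.elements (const 1#) ≈ q × 1#
  sumOver-elements-1 = trans (sumOver-1 F.elements)
    (reflexive (≡.cong (_× 1#)
      (≡.trans (List.length-map E.to (allFin q)) (List.length-tabulate {n = q} id))))

  module _ (f : F.Carrier → Carrier) (f-cong : ∀ {x y} → x F.≈ y → f x ≈ f y) where

    private
      shift : F.Carrier → Fin q → Fin q
      shift b i = E.from (b F.+ E.to i)

      to-shift : ∀ b i → E.to (shift b i) F.≈ b F.+ E.to i
      to-shift b i = E.strictlyInverseˡ _

      shift-inverse : ∀ {b b′} → b F.+ b′ F.≈ F.0# → ∀ i → shift b (shift b′ i) ≡ i
      shift-inverse {b} {b′} b+b′≈0 i = ≡.trans (E.from-cong eq) (E.strictlyInverseʳ i)
        where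
        eq : b F.+ E.to (shift b′ i) F.≈ E.to i
        eq = F.trans (F.+-congˡ (to-shift b′ i)) (F.trans (F.sym (F.+-assoc _ _ _))
               (F.trans (F.+-congʳ b+b′≈0) (F.+-identityˡ _)))

      translation : F.Carrier → Permutation′ q
      translation b = permutation (shift b) (shift (F.- b))
        (shift-inverse (F.-‿inverseʳ b)) (shift-inverse (F.-‿inverseˡ b))

    sumOver-elements-translate : ∀ b →
      sumOver F.elements f ≈ sumOver F.elements (λ x → f (b F.+ x))
    sumOver-elements-translate b = begin
      sumOver F.elements f
        ≈⟨ sumOver-elements f ⟩
      sum (f ∘ E.to)
        ≈⟨ sum-permute (f ∘ E.to) (translation b) ⟩
      sum (λ i → f (E.to (shift b i)))
        ≈⟨ sum-cong-≋ (λ i → f-cong (to-shift b i)) ⟩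
      sum (λ i → f (b F.+ E.to i))
        ≈⟨ sumOver-elements _ ⟨
      sumOver F.elements (λ x → f (b F.+ x)) ∎

    sumOver-elements-nonzero : sumOver F.elements f ≈ f F.0# + sumOver F.elements× f
    sumOver-elements-nonzero = begin
      sumOver F.elements f
        ≈⟨ sumOver-cong F.elements (λ s → 𝟙-split (s F.≟ F.0#) (f s)) ⟩
      sumOver F.elements (λ s → 𝟙 (s F.≟ F.0#) * f s + 𝟙 (¬? (s F.≟ F.0#)) * f s)
        ≈⟨ sumOver-+ F.elements at-zero _ ⟩
      sumOver F.elements at-zero + sumOver F.elements (λ s → 𝟙 (¬? (s F.≟ F.0#)) * f s)
        ≈⟨ +-cong zero-term (sym (sumOver-filter (λ s → ¬? (s F.≟ F.0#)) F.elements f)) ⟩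
      f F.0# + sumOver F.elements× f ∎
      where
      at-zero : F.Carrier → Carrier
      at-zero s = 𝟙 (s F.≟ F.0#) * f s

      zero-term : sumOver F.elements at-zero ≈ f F.0#
      zero-term = begin
        sumOver F.elements at-zero
          ≈⟨ sumOver-elements at-zero ⟩
        sum (at-zero ∘ E.to)
          ≈⟨ sum-single (E.from F.0#) (at-zero ∘ E.to) (λ j j≢ → trans
               (*-congʳ (𝟙-no (E.to j F.≟ F.0#) (λ eq → j≢
                 (≡.trans (≡.sym (E.strictlyInverseʳ j)) (E.from-cong eq)))))
               (zeroˡ _)) ⟩
        at-zero (E.to (E.from F.0#))
          ≈⟨ *-cong (𝟙-yes (_ F.≟ F.0#) (E.strictlyInverseˡ F.0#)) (f-cong (E.strictlyInverseˡ F.0#)) ⟩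
        1# * f F.0#
          ≈⟨ *-identityˡ _ ⟩
        f F.0# ∎

  module _
    (χ      : F.Carrier → Carrier)
    (χ-cong : ∀ {x y} → x F.≈ y → χ x ≈ χ y)
    (χ-+    : ∀ x y → χ (x F.+ y) ≈ χ x * χ y)
    (χ-0    : χ F.0# ≈ 1#)
    where

    characterSum : F.Carrier → Carrier
    characterSum y = sumOver F.elements (λ s → χ (s F.* y))

    characterSum-invariant : ∀ {y} → ¬ y F.≈ F.0# → ∀ a → χ a * characterSum y ≈ characterSum y
    characterSum-invariant {y} y≉0 a with y⁻¹ , y*y⁻¹≈1 ← F.inverse y y≉0 = begin
      χ a * characterSum y
        ≈⟨ *-distribˡ-sumOver F.elements (χ a) _ ⟩
      sumOver F.elements (λ s → χ a * χ (s F.* y))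
        ≈⟨ sumOver-cong F.elements (λ s → χ-+ a (s F.* y)) ⟨
      sumOver F.elements (λ s → χ (a F.+ s F.* y))
        ≈⟨ sumOver-cong F.elements (λ s → χ-cong (shifted s)) ⟨
      sumOver F.elements (λ s → χ ((a F.* y⁻¹ F.+ s) F.* y))
        ≈⟨ sumOver-elements-translate (λ s → χ (s F.* y)) (λ eq → χ-cong (F.*-congʳ eq)) (a F.* y⁻¹) ⟨
      characterSum y ∎
      where
      shifted : ∀ s → (a F.* y⁻¹ F.+ s) F.* y F.≈ a F.+ s F.* y
      shifted s = F.trans (F.distribʳ y _ s) (F.+-congʳ
        (F.trans (F.*-assoc a y⁻¹ y) (F.trans (F.*-congˡ (F.trans (F.*-comm y⁻¹ y) y*y⁻¹≈1))
          (F.*-identityʳ a))))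

    module _
      (vanishing : ∀ {y} → ¬ y F.≈ F.0# → characterSum y ≈ 0#)
      (1/q       : Carrier)
      (1/q*q≈1   : 1/q * (q × 1#) ≈ 1#)
      where

      characterSum-indicator : ∀ y → characterSum y ≈ (q × 1#) * 𝟙 (y F.≟ F.0#)
      characterSum-indicator y = [ at-zero , away-from-zero ]′ (Dec.toSum (y F.≟ F.0#))
        where
        at-zero : y F.≈ F.0# → characterSum y ≈ (q × 1#) * 𝟙 (y F.≟ F.0#)
        at-zero y≈0 = begin
          characterSum y
            ≈⟨ sumOver-cong F.elements (λ s → trans (χ-cong (F.trans (F.*-congˡ y≈0) (F.zeroʳ s))) χ-0) ⟩
          sumOver F.elements (const 1#) ≈⟨ sumOver-elements-1 ⟩
          q × 1#                        ≈⟨ *-identityʳ _ ⟨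
          (q × 1#) * 1#                 ≈⟨ *-congˡ (𝟙-yes (y F.≟ F.0#) y≈0) ⟨
          (q × 1#) * 𝟙 (y F.≟ F.0#)     ∎

        away-from-zero : ¬ y F.≈ F.0# → characterSum y ≈ (q × 1#) * 𝟙 (y F.≟ F.0#)
        away-from-zero y≉0 = begin
          characterSum y            ≈⟨ vanishing y≉0 ⟩
          0#                        ≈⟨ zeroʳ _ ⟨
          (q × 1#) * 0#             ≈⟨ *-congˡ (𝟙-no (y F.≟ F.0#) y≉0) ⟨
          (q × 1#) * 𝟙 (y F.≟ F.0#) ∎

      zeros-by-characters : ∀ (u : F.Carrier → F.Carrier) →
        sumOver F.elements (λ β → 𝟙 (u β F.≟ F.0#))
          ≈ 1# + 1/q * sumOver F.elements× (λ s → sumOver F.elements (λ β → χ (s F.* u β)))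
      zeros-by-characters u = begin
        n                        ≈⟨ *-identityˡ n ⟨
        1# * n                   ≈⟨ *-congʳ 1/q*q≈1 ⟨
        1/q * (q × 1#) * n       ≈⟨ *-assoc _ _ _ ⟩
        1/q * ((q × 1#) * n)     ≈⟨ *-congˡ q*n ⟩
        1/q * (q × 1# + T)       ≈⟨ distribˡ _ _ _ ⟩
        1/q * (q × 1#) + 1/q * T ≈⟨ +-congʳ 1/q*q≈1 ⟩
        1# + 1/q * T             ∎
        where
        n = sumOver F.elements (λ β → 𝟙 (u β F.≟ F.0#))

        slice : F.Carrier → Carrier
        slice s = sumOver F.elements (λ β → χ (s F.* u β))

        T = sumOver F.elements× slice

        q*n : (q × 1#) * n ≈ q × 1# + T
        q*n = begin
          (q × 1#) * n
            ≈⟨ *-distribˡ-sumOver F.elements (q × 1#) _ ⟩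
          sumOver F.elements (λ β → (q × 1#) * 𝟙 (u β F.≟ F.0#))
            ≈⟨ sumOver-cong F.elements (λ β → characterSum-indicator (u β)) ⟨
          sumOver F.elements (λ β → characterSum (u β))
            ≈⟨ sumOver-comm F.elements F.elements (λ s β → χ (s F.* u β)) ⟨
          sumOver F.elements slice
            ≈⟨ sumOver-elements-nonzero slice
                 (λ eq → sumOver-cong F.elements (λ β → χ-cong (F.*-congʳ eq))) ⟩
          slice F.0# + T
            ≈⟨ +-congʳ (sumOver-cong F.elements (λ β → trans (χ-cong (F.zeroˡ (u β))) χ-0)) ⟩
          sumOver F.elements (const 1#) + T
            ≈⟨ +-congʳ sumOver-elements-1 ⟩
          q × 1# + T ∎

      pairs-by-characters :
        ∀ {p} {P : Pred F.Carrier p} (P? : Decidable₁ P) (u : F.Carrier → F.Carrier → F.Carrier) →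
        # (λ (β , γ) → P? γ ×-dec (u β γ F.≟ F.0#)) (cartesianProduct F.elements F.elements) × 1#
          ≈ # P? F.elements × 1# + 1/q * sumOver (filter P? F.elements) (λ γ →
              sumOver F.elements× (λ s → sumOver F.elements (λ β → χ (s F.* u β γ))))
      pairs-by-characters P? u = begin
        # (λ (β , γ) → P? γ ×-dec (u β γ F.≟ F.0#)) (cartesianProduct F.elements F.elements) × 1#
          ≈⟨ #-fibres P? (λ β γ → u β γ F.≟ F.0#) F.elements F.elements ⟩
        sumOver roots (λ γ → sumOver F.elements (λ β → 𝟙 (u β γ F.≟ F.0#)))
          ≈⟨ sumOver-cong roots (λ γ → zeros-by-characters (λ β → u β γ)) ⟩
        sumOver roots (λ γ → 1# + 1/q * T γ)
          ≈⟨ sumOver-+ roots (const 1#) _ ⟩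
        sumOver roots (const 1#) + sumOver roots (λ γ → 1/q * T γ)
          ≈⟨ +-cong (sumOver-1 roots) (sym (*-distribˡ-sumOver roots 1/q T)) ⟩
        # P? F.elements × 1# + 1/q * sumOver roots T ∎
        where
        roots = filter P? F.elements

        T : F.Carrier → Carrier
        T γ = sumOver F.elements× (λ s → sumOver F.elements (λ β → χ (s F.* u β γ)))

Null : (ℕ → ℚ) → Set
Null u = ∀ ε → 0ℚ ℚ.< ε → ∃[ N ] (∀ n → N ℕ.≤ n → ∣ u n ∣ ℚ.< ε)

Null-resp-≗ : ∀ {u v} → (∀ n → u n ≡ v n) → Null u → Null v
Null-resp-≗ u≗v nu ε 0<ε with N , hu ← nu ε 0<ε =
  N , λ n ≤n → ≡.subst (λ p → ∣ p ∣ ℚ.< ε) (u≗v n) (hu n ≤n)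

Null-neg : ∀ {u} → Null u → Null (λ n → ℚ.- u n)
Null-neg {u} nu ε 0<ε with N , hu ← nu ε 0<ε =
  N , λ n ≤n → ≡.subst (ℚ._< ε) (≡.sym (ℚ.∣-p∣≡∣p∣ (u n))) (hu n ≤n)

module _ {ε} (0<ε : 0ℚ ℚ.< ε) where

  0<ε/2 : 0ℚ ℚ.< ½ ℚ.* ε
  0<ε/2 = ≡.subst (ℚ._< ½ ℚ.* ε) (ℚ.*-zeroʳ ½) (ℚ.*-monoʳ-<-pos ½ 0<ε)

  ε/2+ε/2 : ½ ℚ.* ε ℚ.+ ½ ℚ.* ε ≡ ε
  ε/2+ε/2 = ≡.trans (≡.sym (ℚ.*-distribʳ-+ ε ½ ½)) (ℚ.*-identityˡ ε)

Null-+ : ∀ {u v} → Null u → Null v → Null (λ n → u n ℚ.+ v n)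
Null-+ {u} {v} nu nv ε 0<ε
  with M , hu ← nu _ (0<ε/2 0<ε) | N , hv ← nv _ (0<ε/2 0<ε)
  = M ℕ.⊔ N , λ n ≤n → begin-strict
      ∣ u n ℚ.+ v n ∣        ≤⟨ ℚ.∣p+q∣≤∣p∣+∣q∣ (u n) (v n) ⟩
      ∣ u n ∣ ℚ.+ ∣ v n ∣    <⟨ ℚ.+-mono-< (hu n (ℕ.m⊔n≤o⇒m≤o M N ≤n)) (hv n (ℕ.m⊔n≤o⇒n≤o M N ≤n)) ⟩
      ½ ℚ.* ε ℚ.+ ½ ℚ.* ε    ≡⟨ ε/2+ε/2 0<ε ⟩
      ε                      ∎
  where open ℚ.≤-Reasoning

open +-*-Solver using (solve; con; _:=_; _:+_; _:*_; _:-_; :-_)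

≡⇒≈ᴿ : ∀ x y → (∀ n → seq x n ≡ seq y n) → x ≈ᴿ y
≡⇒≈ᴿ x y x≗y ε 0<ε = 0 , λ n _ → ≡.subst (ℚ._< ε)
  (≡.sym (≡.cong ∣_∣ (≡.trans (≡.cong (ℚ._- seq y n) (x≗y n)) (ℚ.+-inverseʳ (seq y n))))) 0<ε

≈ᴿ-sym : ∀ x y → x ≈ᴿ y → y ≈ᴿ x
≈ᴿ-sym x y x≈y = Null-resp-≗
  (λ n → solve 2 (λ a b → :- (a :- b) := b :- a) ≡.refl (seq x n) (seq y n)) (Null-neg x≈y)

≈ᴿ-trans : ∀ x y z → x ≈ᴿ y → y ≈ᴿ z → x ≈ᴿ z
≈ᴿ-trans x y z x≈y y≈z = Null-resp-≗
  (λ n → solve 3 (λ a b c → (a :- b) :+ (b :- c) := a :- c) ≡.refl (seq x n) (seq y n) (seq z n))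
  (Null-+ x≈y y≈z)

+ᴿ-cong : ∀ x x′ y y′ → x ≈ᴿ x′ → y ≈ᴿ y′ → x +ᴿ y ≈ᴿ x′ +ᴿ y′
+ᴿ-cong x x′ y y′ x≈x′ y≈y′ = Null-resp-≗
  (λ n → solve 4 (λ a a′ b b′ → (a :- a′) :+ (b :- b′) := (a :+ b) :- (a′ :+ b′)) ≡.refl
    (seq x n) (seq x′ n) (seq y n) (seq y′ n))
  (Null-+ x≈x′ y≈y′)

-ᴿ-cong : ∀ x x′ → x ≈ᴿ x′ → -ᴿ x ≈ᴿ -ᴿ x′
-ᴿ-cong x x′ x≈x′ = Null-resp-≗
  (λ n → solve 2 (λ a a′ → :- (a :- a′) := :- a :- :- a′) ≡.refl (seq x n) (seq x′ n))
  (Null-neg x≈x′)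

*ᴿ-cong : ∀ x x′ y y′ → x ≈ᴿ x′ → y ≈ᴿ y′ → x *ᴿ y ≈ᴿ x′ *ᴿ y′
*ᴿ-cong x x′ y y′ x≈x′ y≈y′ ε 0<ε = (Kx ℕ.⊔ Ky′) ℕ.⊔ (Lx ℕ.⊔ Ly) , λ n ≤n →
  let
    K≤n = ℕ.m⊔n≤o⇒m≤o (Kx ℕ.⊔ Ky′) (Lx ℕ.⊔ Ly) ≤n
    L≤n = ℕ.m⊔n≤o⇒n≤o (Kx ℕ.⊔ Ky′) (Lx ℕ.⊔ Ly) ≤n
  in proj₂ (proj₂ close) (seq x n) (seq y n) (seq x′ n) (seq y′ n)
       (ℚ.≤-trans (proj₂ (proj₂ (proj₂ bx)) n (ℕ.m⊔n≤o⇒m≤o Kx Ky′ K≤n)) (ℚ.p≤p⊔q Bx By′))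
       (ℚ.≤-trans (proj₂ (proj₂ (proj₂ by′)) n (ℕ.m⊔n≤o⇒n≤o Kx Ky′ K≤n)) (ℚ.p≤q⊔p Bx By′))
       (proj₂ hx n (ℕ.m⊔n≤o⇒m≤o Lx Ly L≤n))
       (proj₂ hy n (ℕ.m⊔n≤o⇒n≤o Lx Ly L≤n))
  where
  bx    = cauchy-bounded (seq x) (cauchy x)
  by′   = cauchy-bounded (seq y′) (cauchy y′)
  Bx    = proj₁ bx
  By′   = proj₁ by′
  Kx    = proj₁ (proj₂ (proj₂ bx))
  Ky′   = proj₁ (proj₂ (proj₂ by′))
  close = *-close (Bx ℚ.⊔ By′) (ℚ.<-≤-trans (proj₁ (proj₂ bx)) (ℚ.p≤p⊔q Bx By′)) ε 0<ε
  hx    = x≈x′ (proj₁ close) (proj₁ (proj₂ close))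
  hy    = y≈y′ (proj₁ close) (proj₁ (proj₂ close))
  Lx    = proj₁ hx
  Ly    = proj₁ hy

Apart : ℝ → Set
Apart x = ∃[ δ ] 0ℚ ℚ.< δ Product.× ∃[ N ] (∀ n → N ℕ.≤ n → δ ℚ.≤ ∣ seq x n ∣)

p-0≡p : ∀ p → p ℚ.- 0ℚ ≡ p
p-0≡p = solve 1 (λ a → a :- con 0ℚ := a) ≡.refl

-- With a modulus of convergence at hand, one can decide whether a term far
-- out is large enough to keep the sequence away from 0 or small enough to
-- keep it below ε.
¬Apart⇒≈0 : ∀ x → ¬ Apart x → x ≈ᴿ 0ᴿ
¬Apart⇒≈0 x ¬apart = Null-resp-≗ (λ n → ≡.sym (p-0≡p (seq x n))) small
  where
  open ℚ.≤-Reasoning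
  near : ∀ p r → ∣ p ∣ ℚ.≤ ∣ r ∣ ℚ.+ ∣ p ℚ.- r ∣
  near p r = begin
    ∣ p ∣                  ≡⟨ ≡.cong ∣_∣ (solve 2 (λ p r → p := r :+ (p :- r)) ≡.refl p r) ⟩
    ∣ r ℚ.+ (p ℚ.- r) ∣    ≤⟨ ℚ.∣p+q∣≤∣p∣+∣q∣ r (p ℚ.- r) ⟩
    ∣ r ∣ ℚ.+ ∣ p ℚ.- r ∣  ∎

  small : Null (seq x)
  small ε 0<ε with N , hx ← cauchy x _ (0<ε/2 (0<ε/2 0<ε))
                 | ∣ seq x N ∣ ℚ.<? ½ ℚ.* ε
  ... | yes ∣xN∣<h = N , λ n ≤n → begin-strict
    ∣ seq x n ∣                                 ≤⟨ near (seq x n) (seq x N) ⟩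
    ∣ seq x N ∣ ℚ.+ ∣ seq x n ℚ.- seq x N ∣     <⟨ ℚ.+-mono-< ∣xN∣<h (hx n N ≤n ℕ.≤-refl) ⟩
    ½ ℚ.* ε ℚ.+ ½ ℚ.* (½ ℚ.* ε)                 ≤⟨ ℚ.+-monoʳ-≤ (½ ℚ.* ε) (ℚ.<⇒≤ quarter<half) ⟩
    ½ ℚ.* ε ℚ.+ ½ ℚ.* ε                         ≡⟨ ε/2+ε/2 0<ε ⟩
    ε                                           ∎
    where
    quarter<half : ½ ℚ.* (½ ℚ.* ε) ℚ.< ½ ℚ.* ε
    quarter<half = begin-strict
      ½ ℚ.* (½ ℚ.* ε)                        ≡⟨ ℚ.+-identityˡ _ ⟨
      0ℚ ℚ.+ ½ ℚ.* (½ ℚ.* ε)                 <⟨ ℚ.+-monoˡ-< _ (0<ε/2 (0<ε/2 0<ε)) ⟩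
      ½ ℚ.* (½ ℚ.* ε) ℚ.+ ½ ℚ.* (½ ℚ.* ε)    ≡⟨ ε/2+ε/2 (0<ε/2 0<ε) ⟩
      ½ ℚ.* ε                                ∎
  ... | no ∣xN∣≮h = contradiction (k , 0<ε/2 (0<ε/2 0<ε) , N , far) ¬apart
    where
    k = ½ ℚ.* (½ ℚ.* ε)

    far : ∀ n → N ℕ.≤ n → k ℚ.≤ ∣ seq x n ∣
    far n ≤n = begin
      k                                ≡⟨ solve 1 (λ k → k := (k :+ k) :+ :- k) ≡.refl k ⟩
      (k ℚ.+ k) ℚ.+ ℚ.- k              ≡⟨ ≡.cong (ℚ._+ ℚ.- k) (ε/2+ε/2 (0<ε/2 0<ε)) ⟩
      ½ ℚ.* ε ℚ.+ ℚ.- k                ≤⟨ ℚ.+-monoˡ-≤ (ℚ.- k) (ℚ.≮⇒≥ ∣xN∣≮h) ⟩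
      ∣ seq x N ∣ ℚ.+ ℚ.- k            ≤⟨ ℚ.+-monoˡ-≤ (ℚ.- k) (near (seq x N) (seq x n)) ⟩
      (∣ seq x n ∣ ℚ.+ ∣ seq x N ℚ.- seq x n ∣) ℚ.+ ℚ.- k
        ≤⟨ ℚ.+-monoˡ-≤ (ℚ.- k) (ℚ.+-monoʳ-≤ ∣ seq x n ∣ (ℚ.<⇒≤ (hx N n ℕ.≤-refl ≤n))) ⟩
      (∣ seq x n ∣ ℚ.+ k) ℚ.+ ℚ.- k    ≡⟨ solve 2 (λ a k → (a :+ k) :+ :- k := a) ≡.refl ∣ seq x n ∣ k ⟩
      ∣ seq x n ∣                      ∎

Apart-cancelʳ : ∀ x y → Apart y → x *ᴿ y ≈ᴿ 0ᴿ → x ≈ᴿ 0ᴿ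
Apart-cancelʳ x y (δ , 0<δ , M , δ≤y) xy≈0 = Null-resp-≗ (λ n → ≡.sym (p-0≡p (seq x n))) small
  where
  open ℚ.≤-Reasoning
  instance
    δ-pos : ℚ.Positive δ
    δ-pos = ℚ.positive 0<δ

  small : Null (seq x)
  small ε 0<ε with N , hxy ← xy≈0 (ε ℚ.* δ) (ℚ.positive⁻¹ _ {{ℚ.pos*pos⇒pos ε {{ℚ.positive 0<ε}} δ}}) =
    M ℕ.⊔ N , λ n ≤n → ℚ.*-cancelʳ-<-nonNeg δ {{ℚ.pos⇒nonNeg δ}} (begin-strict
      ∣ seq x n ∣ ℚ.* δ                ≤⟨ ℚ.*-monoˡ-≤-nonNeg ∣ seq x n ∣ {{ℚ.∣-∣-nonNeg (seq x n)}} (δ≤y n (ℕ.m⊔n≤o⇒m≤o M N ≤n)) ⟩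
      ∣ seq x n ∣ ℚ.* ∣ seq y n ∣      ≡⟨ ℚ.∣p*q∣≡∣p∣*∣q∣ (seq x n) (seq y n) ⟨
      ∣ seq x n ℚ.* seq y n ∣          ≡⟨ ≡.cong ∣_∣ (p-0≡p _) ⟨
      ∣ seq x n ℚ.* seq y n ℚ.- 0ℚ ∣   <⟨ hxy n (ℕ.m⊔n≤o⇒n≤o M N ≤n) ⟩
      ε ℚ.* δ                          ∎)

∣p∣*∣p∣≡p*p : ∀ p → ∣ p ∣ ℚ.* ∣ p ∣ ≡ p ℚ.* p
∣p∣*∣p∣≡p*p p with ℚ.∣p∣≡p∨∣p∣≡-p p
... | inj₁ eq = ≡.cong₂ ℚ._*_ eq eq
... | inj₂ eq = ≡.trans (≡.cong₂ ℚ._*_ eq eq) (solve 1 (λ a → :- a :* :- a := a :* a) ≡.refl p)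

0≤p*p : ∀ p → 0ℚ ℚ.≤ p ℚ.* p
0≤p*p p = ≡.subst (0ℚ ℚ.≤_) (∣p∣*∣p∣≡p*p p)
  (ℚ.nonNegative⁻¹ _ {{ℚ.nonNeg*nonNeg⇒nonNeg (∣ p ∣) {{ℚ.∣-∣-nonNeg p}} (∣ p ∣) {{ℚ.∣-∣-nonNeg p}}}})

sum-of-squares≈0 : ∀ x y → x *ᴿ x +ᴿ y *ᴿ y ≈ᴿ 0ᴿ → x ≈ᴿ 0ᴿ
sum-of-squares≈0 x y h = Null-resp-≗ (λ n → ≡.sym (p-0≡p (seq x n))) small
  where
  open ℚ.≤-Reasoning
  bound : ∀ {ε} → 0ℚ ℚ.< ε → ∀ p r → ∣ p ℚ.* p ℚ.+ r ℚ.* r ℚ.- 0ℚ ∣ ℚ.< ε ℚ.* ε → ∣ p ∣ ℚ.< ε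
  bound {ε} 0<ε p r pp+rr<εε = ℚ.≰⇒> λ ε≤∣p∣ → ℚ.<-irrefl ≡.refl (begin-strict
    ε ℚ.* ε                          ≤⟨ ℚ.*-monoˡ-≤-nonNeg ε {{ε-nonNeg}} ε≤∣p∣ ⟩
    ε ℚ.* ∣ p ∣                      ≤⟨ ℚ.*-monoʳ-≤-nonNeg (∣ p ∣) {{ℚ.∣-∣-nonNeg p}} ε≤∣p∣ ⟩
    ∣ p ∣ ℚ.* ∣ p ∣                  ≡⟨ ∣p∣*∣p∣≡p*p p ⟩
    p ℚ.* p                          ≡⟨ ℚ.+-identityʳ _ ⟨
    p ℚ.* p ℚ.+ 0ℚ                   ≤⟨ ℚ.+-monoʳ-≤ (p ℚ.* p) (0≤p*p r) ⟩
    p ℚ.* p ℚ.+ r ℚ.* r              ≡⟨ ℚ.0≤p⇒∣p∣≡p (ℚ.+-mono-≤ (0≤p*p p) (0≤p*p r)) ⟨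
    ∣ p ℚ.* p ℚ.+ r ℚ.* r ∣          ≡⟨ ≡.cong ∣_∣ (p-0≡p _) ⟨
    ∣ p ℚ.* p ℚ.+ r ℚ.* r ℚ.- 0ℚ ∣   <⟨ pp+rr<εε ⟩
    ε ℚ.* ε                          ∎)
    where
    ε-nonNeg : ℚ.NonNegative ε
    ε-nonNeg = ℚ.pos⇒nonNeg ε {{ℚ.positive 0<ε}}

  small : Null (seq x)
  small ε 0<ε with N , h′ ← h (ε ℚ.* ε)
      (ℚ.positive⁻¹ _ {{ℚ.pos*pos⇒pos ε {{ℚ.positive 0<ε}} ε {{ℚ.positive 0<ε}}}}) =
    N , λ n ≤n → bound 0<ε (seq x n) (seq y n) (h′ n ≤n)

≡⇒≈ᶜ : ∀ z w → (∀ n → seq (re z) n ≡ seq (re w) n) → (∀ n → seq (im z) n ≡ seq (im w) n) → z ≈ᶜ w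
≡⇒≈ᶜ z w re≡ im≡ = ≡⇒≈ᴿ (re z) (re w) re≡ , ≡⇒≈ᴿ (im z) (im w) im≡

+ᶜ-cong : ∀ z z′ w w′ → z ≈ᶜ z′ → w ≈ᶜ w′ → z +ᶜ w ≈ᶜ z′ +ᶜ w′
+ᶜ-cong z z′ w w′ (re≈ , im≈) (re≈′ , im≈′) =
  +ᴿ-cong (re z) (re z′) (re w) (re w′) re≈ re≈′ ,
  +ᴿ-cong (im z) (im z′) (im w) (im w′) im≈ im≈′

*ᶜ-cong : ∀ z z′ w w′ → z ≈ᶜ z′ → w ≈ᶜ w′ → z *ᶜ w ≈ᶜ z′ *ᶜ w′
*ᶜ-cong z z′ w w′ (re≈ , im≈) (re≈′ , im≈′) =
  +ᴿ-cong (re z *ᴿ re w) (re z′ *ᴿ re w′) (-ᴿ (im z *ᴿ im w)) (-ᴿ (im z′ *ᴿ im w′))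
    (*ᴿ-cong (re z) (re z′) (re w) (re w′) re≈ re≈′)
    (-ᴿ-cong (im z *ᴿ im w) (im z′ *ᴿ im w′) (*ᴿ-cong (im z) (im z′) (im w) (im w′) im≈ im≈′)) ,
  +ᴿ-cong (re z *ᴿ im w) (re z′ *ᴿ im w′) (im z *ᴿ re w) (im z′ *ᴿ re w′)
    (*ᴿ-cong (re z) (re z′) (im w) (im w′) re≈ im≈′)
    (*ᴿ-cong (im z) (im z′) (re w) (re w′) im≈ re≈′)

*ᶜ-comm : ∀ z w → z *ᶜ w ≈ᶜ w *ᶜ z
*ᶜ-comm z w = ≡⇒≈ᶜ (z *ᶜ w) (w *ᶜ z)
  (λ n → solve 4 (λ a b c d → a :* c :- b :* d := c :* a :- d :* b) ≡.refl
    (seq (re z) n) (seq (im z) n) (seq (re w) n) (seq (im w) n))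
  (λ n → solve 4 (λ a b c d → a :* d :+ b :* c := c :* b :+ d :* a) ≡.refl
    (seq (re z) n) (seq (im z) n) (seq (re w) n) (seq (im w) n))

*ᶜ-assoc : ∀ z w v → z *ᶜ w *ᶜ v ≈ᶜ z *ᶜ (w *ᶜ v)
*ᶜ-assoc z w v = ≡⇒≈ᶜ (z *ᶜ w *ᶜ v) (z *ᶜ (w *ᶜ v))
  (λ n → solve 6 (λ a b c d e f →
      (a :* c :- b :* d) :* e :- (a :* d :+ b :* c) :* f
        := a :* (c :* e :- d :* f) :- b :* (c :* f :+ d :* e)) ≡.refl
    (seq (re z) n) (seq (im z) n) (seq (re w) n) (seq (im w) n) (seq (re v) n) (seq (im v) n))
  (λ n → solve 6 (λ a b c d e f →
      (a :* c :- b :* d) :* f :+ (a :* d :+ b :* c) :* e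
        := a :* (c :* f :+ d :* e) :+ b :* (c :* e :- d :* f)) ≡.refl
    (seq (re z) n) (seq (im z) n) (seq (re w) n) (seq (im w) n) (seq (re v) n) (seq (im v) n))

*ᶜ-identityˡ : ∀ z → ℚ⇒ℂ 1ℚ *ᶜ z ≈ᶜ z
*ᶜ-identityˡ z = ≡⇒≈ᶜ (ℚ⇒ℂ 1ℚ *ᶜ z) z
  (λ n → solve 2 (λ a b → con 1ℚ :* a :- con 0ℚ :* b := a) ≡.refl (seq (re z) n) (seq (im z) n))
  (λ n → solve 2 (λ a b → con 1ℚ :* b :+ con 0ℚ :* a := b) ≡.refl (seq (re z) n) (seq (im z) n))

*ᶜ-identityʳ : ∀ z → z *ᶜ ℚ⇒ℂ 1ℚ ≈ᶜ z
*ᶜ-identityʳ z = ≡⇒≈ᶜ (z *ᶜ ℚ⇒ℂ 1ℚ) z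
  (λ n → solve 2 (λ a b → a :* con 1ℚ :- b :* con 0ℚ := a) ≡.refl (seq (re z) n) (seq (im z) n))
  (λ n → solve 2 (λ a b → a :* con 0ℚ :+ b :* con 1ℚ := b) ≡.refl (seq (re z) n) (seq (im z) n))

*ᶜ-distribˡ-+ᶜ : ∀ z w v → z *ᶜ (w +ᶜ v) ≈ᶜ z *ᶜ w +ᶜ z *ᶜ v
*ᶜ-distribˡ-+ᶜ z w v = ≡⇒≈ᶜ (z *ᶜ (w +ᶜ v)) (z *ᶜ w +ᶜ z *ᶜ v)
  (λ n → solve 6 (λ a b c d e f →
      a :* (c :+ e) :- b :* (d :+ f) := (a :* c :- b :* d) :+ (a :* e :- b :* f)) ≡.refl
    (seq (re z) n) (seq (im z) n) (seq (re w) n) (seq (im w) n) (seq (re v) n) (seq (im v) n))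
  (λ n → solve 6 (λ a b c d e f →
      a :* (d :+ f) :+ b :* (c :+ e) := (a :* d :+ b :* c) :+ (a :* f :+ b :* e)) ≡.refl
    (seq (re z) n) (seq (im z) n) (seq (re w) n) (seq (im w) n) (seq (re v) n) (seq (im v) n))

*ᶜ-distribʳ-+ᶜ : ∀ v z w → (z +ᶜ w) *ᶜ v ≈ᶜ z *ᶜ v +ᶜ w *ᶜ v
*ᶜ-distribʳ-+ᶜ v z w = ≡⇒≈ᶜ ((z +ᶜ w) *ᶜ v) (z *ᶜ v +ᶜ w *ᶜ v)
  (λ n → solve 6 (λ a b c d e f →
      (a :+ c) :* e :- (b :+ d) :* f := (a :* e :- b :* f) :+ (c :* e :- d :* f)) ≡.refl
    (seq (re z) n) (seq (im z) n) (seq (re w) n) (seq (im w) n) (seq (re v) n) (seq (im v) n))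
  (λ n → solve 6 (λ a b c d e f →
      (a :+ c) :* f :+ (b :+ d) :* e := (a :* f :+ b :* e) :+ (c :* f :+ d :* e)) ≡.refl
    (seq (re z) n) (seq (im z) n) (seq (re w) n) (seq (im w) n) (seq (re v) n) (seq (im v) n))

-- The operations are sealed, since unfolding them makes the conversion checker
-- compare proofs of the Cauchy property.
infix  4 _≋_
infixl 6 _⊕_
infixl 7 _⊗_
infix  8 ⊖_

opaque

  _≋_ : ℂ → ℂ → Set
  _≋_ = _≈ᶜ_

  _⊕_ _⊗_ : ℂ → ℂ → ℂ
  _⊕_ = _+ᶜ_
  _⊗_ = _*ᶜ_

  ⊖_ : ℂ → ℂ
  ⊖_ = -ᶜ_

  ≈ᶜ⇒≋ : ∀ z w → z ≈ᶜ w → z ≋ w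
  ≈ᶜ⇒≋ _ _ z≈w = z≈w

  ≋⇒≈ᶜ : ∀ z w → z ≋ w → z ≈ᶜ w
  ≋⇒≈ᶜ _ _ z≋w = z≋w

  ⊕≡+ᶜ : ∀ z w → z ⊕ w ≡ z +ᶜ w
  ⊕≡+ᶜ _ _ = ≡.refl

  ⊗≡*ᶜ : ∀ z w → z ⊗ w ≡ z *ᶜ w
  ⊗≡*ᶜ _ _ = ≡.refl

  ℂ-isCommutativeRing : IsCommutativeRing _≋_ _⊕_ _⊗_ ⊖_ (ℚ⇒ℂ 0ℚ) (ℚ⇒ℂ 1ℚ)
  ℂ-isCommutativeRing = record
    { isRing = record
      { +-isAbelianGroup = record
        { isGroup = record
          { isMonoid = record
            { isSemigroup = record
              { isMagma = record
                { isEquivalence = record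
                  { refl  = λ {z} → ≡⇒≈ᶜ z z (λ _ → ≡.refl) (λ _ → ≡.refl)
                  ; sym   = λ {z} {w} (r , i) → ≈ᴿ-sym (re z) (re w) r , ≈ᴿ-sym (im z) (im w) i
                  ; trans = λ {z} {w} {v} (r , i) (r′ , i′) →
                      ≈ᴿ-trans (re z) (re w) (re v) r r′ , ≈ᴿ-trans (im z) (im w) (im v) i i′
                  }
                ; ∙-cong = λ {z} {z′} {w} {w′} → +ᶜ-cong z z′ w w′
                }
              ; assoc = λ z w v → ≡⇒≈ᶜ (z +ᶜ w +ᶜ v) (z +ᶜ (w +ᶜ v))
                  (λ n → ℚ.+-assoc (seq (re z) n) (seq (re w) n) (seq (re v) n))
                  (λ n → ℚ.+-assoc (seq (im z) n) (seq (im w) n) (seq (im v) n))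
              }
            ; identity =
                (λ z → ≡⇒≈ᶜ (ℚ⇒ℂ 0ℚ +ᶜ z) z
                  (λ n → ℚ.+-identityˡ (seq (re z) n)) (λ n → ℚ.+-identityˡ (seq (im z) n))) ,
                (λ z → ≡⇒≈ᶜ (z +ᶜ ℚ⇒ℂ 0ℚ) z
                  (λ n → ℚ.+-identityʳ (seq (re z) n)) (λ n → ℚ.+-identityʳ (seq (im z) n)))
            }
          ; inverse =
              (λ z → ≡⇒≈ᶜ (-ᶜ z +ᶜ z) (ℚ⇒ℂ 0ℚ)
                (λ n → ℚ.+-inverseˡ (seq (re z) n)) (λ n → ℚ.+-inverseˡ (seq (im z) n))) ,
              (λ z → ≡⇒≈ᶜ (z +ᶜ -ᶜ z) (ℚ⇒ℂ 0ℚ)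
                (λ n → ℚ.+-inverseʳ (seq (re z) n)) (λ n → ℚ.+-inverseʳ (seq (im z) n)))
          ; ⁻¹-cong = λ {z} {w} (r , i) → -ᴿ-cong (re z) (re w) r , -ᴿ-cong (im z) (im w) i
          }
        ; comm = λ z w → ≡⇒≈ᶜ (z +ᶜ w) (w +ᶜ z)
            (λ n → ℚ.+-comm (seq (re z) n) (seq (re w) n))
            (λ n → ℚ.+-comm (seq (im z) n) (seq (im w) n))
        }
      ; *-cong     = λ {z} {z′} {w} {w′} → *ᶜ-cong z z′ w w′
      ; *-assoc    = *ᶜ-assoc
      ; *-identity = *ᶜ-identityˡ , *ᶜ-identityʳ
      ; distrib    = *ᶜ-distribˡ-+ᶜ , *ᶜ-distribʳ-+ᶜ
      }
    ; *-comm = *ᶜ-comm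
    }

ℂ-commutativeRing : CommutativeRing 0ℓ 0ℓ
ℂ-commutativeRing = record { isCommutativeRing = ℂ-isCommutativeRing }

module ℂ-ring = CommutativeRing ℂ-commutativeRing

infix 8 _†
_† : ℂ → ℂ
z † = re z +i (-ᴿ im z)

normSq : ℂ → ℝ
normSq z = re z *ᴿ re z +ᴿ im z *ᴿ im z

normSq≈0⇒≈0 : ∀ z → normSq z ≈ᴿ 0ᴿ → z ≈ᶜ ℚ⇒ℂ 0ℚ
normSq≈0⇒≈0 z h = sum-of-squares≈0 (re z) (im z) h ,
  sum-of-squares≈0 (im z) (re z)
    (≈ᴿ-trans (im z *ᴿ im z +ᴿ re z *ᴿ re z) (normSq z) 0ᴿ
      (≡⇒≈ᴿ (im z *ᴿ im z +ᴿ re z *ᴿ re z) (normSq z)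
        (λ n → ℚ.+-comm (seq (im z) n ℚ.* seq (im z) n) (seq (re z) n ℚ.* seq (re z) n)))
      h)

*ᶜ-cancelʳ : ∀ z w → Apart (normSq w) → z *ᶜ w ≈ᶜ ℚ⇒ℂ 0ℚ → z ≈ᶜ ℚ⇒ℂ 0ℚ
*ᶜ-cancelʳ z w w#0 zw≈0 =
  Apart-cancelʳ (re z) (normSq w) w#0
    (≈ᴿ-trans (re z *ᴿ normSq w) (re (z *ᶜ w *ᶜ w †)) 0ᴿ
      (≡⇒≈ᴿ (re z *ᴿ normSq w) (re (z *ᶜ w *ᶜ w †))
        (λ n → solve 4 (λ a b c d → a :* (c :* c :+ d :* d)
            := (a :* c :- b :* d) :* c :- (a :* d :+ b :* c) :* :- d) ≡.refl
          (seq (re z) n) (seq (im z) n) (seq (re w) n) (seq (im w) n)))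
      (≈ᴿ-trans (re (z *ᶜ w *ᶜ w †)) (re (ℚ⇒ℂ 0ℚ *ᶜ w †)) 0ᴿ (proj₁ zww†≈0w†)
        (≡⇒≈ᴿ (re (ℚ⇒ℂ 0ℚ *ᶜ w †)) 0ᴿ
          (λ n → solve 2 (λ c d → con 0ℚ :* c :- con 0ℚ :* :- d := con 0ℚ) ≡.refl
            (seq (re w) n) (seq (im w) n))))) ,
  Apart-cancelʳ (im z) (normSq w) w#0
    (≈ᴿ-trans (im z *ᴿ normSq w) (im (z *ᶜ w *ᶜ w †)) 0ᴿ
      (≡⇒≈ᴿ (im z *ᴿ normSq w) (im (z *ᶜ w *ᶜ w †))
        (λ n → solve 4 (λ a b c d → b :* (c :* c :+ d :* d)
            := (a :* c :- b :* d) :* :- d :+ (a :* d :+ b :* c) :* c) ≡.refl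
          (seq (re z) n) (seq (im z) n) (seq (re w) n) (seq (im w) n)))
      (≈ᴿ-trans (im (z *ᶜ w *ᶜ w †)) (im (ℚ⇒ℂ 0ℚ *ᶜ w †)) 0ᴿ (proj₂ zww†≈0w†)
        (≡⇒≈ᴿ (im (ℚ⇒ℂ 0ℚ *ᶜ w †)) 0ᴿ
          (λ n → solve 2 (λ c d → con 0ℚ :* :- d :+ con 0ℚ :* c := con 0ℚ) ≡.refl
            (seq (re w) n) (seq (im w) n)))))
  where
  zww†≈0w† : z *ᶜ w *ᶜ w † ≈ᶜ ℚ⇒ℂ 0ℚ *ᶜ w †
  zww†≈0w† = *ᶜ-cong (z *ᶜ w) (ℚ⇒ℂ 0ℚ) (w †) (w †) zw≈0 (≡⇒≈ᶜ (w †) (w †) (λ _ → ≡.refl) (λ _ → ≡.refl))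

⊗-cancelʳ : ∀ z w → Apart (normSq w) → z ⊗ w ≋ ℚ⇒ℂ 0ℚ → z ≋ ℚ⇒ℂ 0ℚ
⊗-cancelʳ z w w#0 zw≋0 = ≈ᶜ⇒≋ z (ℚ⇒ℂ 0ℚ) (*ᶜ-cancelʳ z w w#0
  (≡.subst (_≈ᶜ ℚ⇒ℂ 0ℚ) (⊗≡*ᶜ z w) (≋⇒≈ᶜ (z ⊗ w) (ℚ⇒ℂ 0ℚ) zw≋0)))

-- If w were apart from 0, then every z x would be 1; so no particular x with
-- z x ≠ 1 has to be exhibited.
common-eigenvector≋0 : ∀ {a} {A : Set a} (z : A → ℂ) w →
  ¬ (∀ x → z x ≈ᶜ ℚ⇒ℂ 1ℚ) → (∀ x → z x ⊗ w ≋ w) → w ≋ ℚ⇒ℂ 0ℚ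
common-eigenvector≋0 z w nontrivial fixed = ≈ᶜ⇒≋ w (ℚ⇒ℂ 0ℚ) (normSq≈0⇒≈0 w
  (¬Apart⇒≈0 (normSq w) λ w#0 → nontrivial λ x → ≋⇒≈ᶜ (z x) (ℚ⇒ℂ 1ℚ)
    (x∙y⁻¹≈ε⇒x≈y (z x) (ℚ⇒ℂ 1ℚ) (⊗-cancelʳ (z x ⊕ ⊖ ℚ⇒ℂ 1ℚ) w w#0 (begin
      (z x ⊕ ⊖ ℚ⇒ℂ 1ℚ) ⊗ w         ≈⟨ [y-z]x≈yx-zx w (z x) (ℚ⇒ℂ 1ℚ) ⟩
      z x ⊗ w ⊕ ⊖ (ℚ⇒ℂ 1ℚ ⊗ w)     ≈⟨ ℂ-ring.+-cong (fixed x) (ℂ-ring.-‿cong (ℂ-ring.*-identityˡ w)) ⟩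
      w ⊕ ⊖ w                      ≈⟨ ℂ-ring.-‿inverseʳ w ⟩
      ℚ⇒ℂ 0ℚ                       ∎)))))
  where
  open import Algebra.Properties.Ring ℂ-ring.ring using ([y-z]x≈yx-zx)
  open import Algebra.Properties.Group ℂ-ring.+-group using (x∙y⁻¹≈ε⇒x≈y)
  open ≈-Reasoning ℂ-ring.setoid

toℚᵘ-/ : ∀ i n .{{_ : ℕ.NonZero n}} → ℚ.toℚᵘ (i ℚ./ n) ℚᵘ.≃ i ℚᵘ./ n
toℚᵘ-/ i (suc n) = ℚ.toℚᵘ-fromℚᵘ (ℚᵘ.mkℚᵘ i n)

1+n/1 : ∀ n → + suc n ℚ./ 1 ≡ 1ℚ ℚ.+ + n ℚ./ 1
1+n/1 n = ℚ.toℚᵘ-injective (begin-equality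
  ℚ.toℚᵘ (+ suc n ℚ./ 1)               ≃⟨ toℚᵘ-/ (+ suc n) 1 ⟩
  + suc n ℚᵘ./ 1                       ≃⟨ ℚᵘ.*≡* (≡.cong (λ i → (ℤ.1ℤ ℤ.+ i) ℤ.* + 1) (≡.sym (ℤ.*-identityʳ (+ n)))) ⟩
  ℚᵘ.1ℚᵘ ℚᵘ.+ + n ℚᵘ./ 1               ≃⟨ ℚᵘ.+-congʳ ℚᵘ.1ℚᵘ (toℚᵘ-/ (+ n) 1) ⟨
  ℚᵘ.1ℚᵘ ℚᵘ.+ ℚ.toℚᵘ (+ n ℚ./ 1)       ≃⟨ ℚ.toℚᵘ-homo-+ 1ℚ (+ n ℚ./ 1) ⟨
  ℚ.toℚᵘ (1ℚ ℚ.+ + n ℚ./ 1)            ∎)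
  where open ℚᵘ.≤-Reasoning

1/n*n/1 : ∀ n .{{_ : ℕ.NonZero n}} → (+ 1 ℚ./ n) ℚ.* (+ n ℚ./ 1) ≡ 1ℚ
1/n*n/1 n@(suc _) = ℚ.toℚᵘ-injective (begin-equality
  ℚ.toℚᵘ ((+ 1 ℚ./ n) ℚ.* (+ n ℚ./ 1))             ≃⟨ ℚ.toℚᵘ-homo-* (+ 1 ℚ./ n) (+ n ℚ./ 1) ⟩
  ℚ.toℚᵘ (+ 1 ℚ./ n) ℚᵘ.* ℚ.toℚᵘ (+ n ℚ./ 1)       ≃⟨ ℚᵘ.*-cong (toℚᵘ-/ (+ 1) n) (toℚᵘ-/ (+ n) 1) ⟩
  (+ 1 ℚᵘ./ n) ℚᵘ.* (+ n ℚᵘ./ 1)                   ≃⟨ ℚᵘ.*≡* (ℤ.*-assoc (+ 1) (+ n) (+ 1)) ⟩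
  ℚᵘ.1ℚᵘ                                           ∎)
  where open ℚᵘ.≤-Reasoning

open import Algebra.Definitions.RawMonoid ℂ-ring.+-rawMonoid using (_×_)

ℕ⇒ℂ≋×1 : ∀ n → ℕ⇒ℂ n ≋ n × ℚ⇒ℂ 1ℚ
ℕ⇒ℂ≋×1 ℕ.zero  = ℂ-ring.refl
ℕ⇒ℂ≋×1 (suc n) = begin
  ℕ⇒ℂ (suc n)
    ≈⟨ ≈ᶜ⇒≋ (ℕ⇒ℂ (suc n)) (ℚ⇒ℂ 1ℚ +ᶜ ℕ⇒ℂ n)
         (≡⇒≈ᶜ (ℕ⇒ℂ (suc n)) (ℚ⇒ℂ 1ℚ +ᶜ ℕ⇒ℂ n) (λ _ → 1+n/1 n) (λ _ → ≡.refl)) ⟩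
  ℚ⇒ℂ 1ℚ +ᶜ ℕ⇒ℂ n
    ≡⟨ ⊕≡+ᶜ (ℚ⇒ℂ 1ℚ) (ℕ⇒ℂ n) ⟨
  ℚ⇒ℂ 1ℚ ⊕ ℕ⇒ℂ n
    ≈⟨ ℂ-ring.+-congˡ (ℕ⇒ℂ≋×1 n) ⟩
  ℚ⇒ℂ 1ℚ ⊕ n × ℚ⇒ℂ 1ℚ ∎
  where open ≈-Reasoning ℂ-ring.setoid

ℚ⇒ℂ-1/n⊗n≋1 : ∀ n .{{_ : ℕ.NonZero n}} → ℚ⇒ℂ (+ 1 ℚ./ n) ⊗ (n × ℚ⇒ℂ 1ℚ) ≋ ℚ⇒ℂ 1ℚ
ℚ⇒ℂ-1/n⊗n≋1 n = begin
  1/n ⊗ (n × ℚ⇒ℂ 1ℚ)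
    ≈⟨ ℂ-ring.*-congˡ (ℕ⇒ℂ≋×1 n) ⟨
  1/n ⊗ ℕ⇒ℂ n
    ≡⟨ ⊗≡*ᶜ 1/n (ℕ⇒ℂ n) ⟩
  1/n *ᶜ ℕ⇒ℂ n
    ≈⟨ ≈ᶜ⇒≋ (1/n *ᶜ ℕ⇒ℂ n) (ℚ⇒ℂ 1ℚ) (≡⇒≈ᶜ (1/n *ᶜ ℕ⇒ℂ n) (ℚ⇒ℂ 1ℚ)
         (λ _ → ≡.trans (p-0≡p ((+ 1 ℚ./ n) ℚ.* (+ n ℚ./ 1))) (1/n*n/1 n))
         (λ _ → solve 2 (λ a b → a :* con 0ℚ :+ con 0ℚ :* b := con 0ℚ) ≡.refl (+ 1 ℚ./ n) (+ n ℚ./ 1))) ⟩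
  ℚ⇒ℂ 1ℚ ∎
  where
  open ≈-Reasoning ℂ-ring.setoid
  1/n = ℚ⇒ℂ (+ 1 ℚ./ n)

-- Unlike ∑ xs f, the fold leaves G to unification, which finds it without
-- unfolding the sums nested in it.
foldr≋sumOver : ∀ {a} {A : Set a} (xs : List A) {G : A → ℂ → ℂ} (f : A → ℂ) →
  (∀ x w → G x w ≈ᶜ f x ⊕ w) → foldr G (ℚ⇒ℂ 0ℚ) xs ≋ Summation.sumOver ℂ-commutativeRing xs f
foldr≋sumOver []       f G≈f = ℂ-ring.refl
foldr≋sumOver (x ∷ xs) {G} f G≈f = ℂ-ring.trans
  (≈ᶜ⇒≋ (G x (foldr G (ℚ⇒ℂ 0ℚ) xs)) (f x ⊕ foldr G (ℚ⇒ℂ 0ℚ) xs) (G≈f x (foldr G (ℚ⇒ℂ 0ℚ) xs)))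
  (ℂ-ring.+-congˡ (foldr≋sumOver xs f G≈f))

foldr+ᶜ≈sumOver⊕ : ∀ {a} {A : Set a} (xs : List A) {G : A → ℂ → ℂ} (f : A → ℂ) →
  (∀ x w → G x w ≈ᶜ f x ⊕ w) → ∀ w →
  foldr G (ℚ⇒ℂ 0ℚ) xs +ᶜ w ≈ᶜ Summation.sumOver ℂ-commutativeRing xs f ⊕ w
foldr+ᶜ≈sumOver⊕ xs {G} f G≈f w =
  ≋⇒≈ᶜ (foldr G (ℚ⇒ℂ 0ℚ) xs +ᶜ w) (Summation.sumOver ℂ-commutativeRing xs f ⊕ w)
    (≡.subst (_≋ Summation.sumOver ℂ-commutativeRing xs f ⊕ w) (⊕≡+ᶜ (foldr G (ℚ⇒ℂ 0ℚ) xs) w)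
      (ℂ-ring.+-congʳ (foldr≋sumOver xs f G≈f)))

module _ {c ℓ : Level} {q : ℕ} (F : FiniteField c ℓ q) where

  open FiniteField F using (Carrier; 0#; _*_; _+_; _≈_; elements; 1/order; order-nonZero)
  open OverFiniteField F
  open Summation ℂ-commutativeRing using (sumOver)
  open CharacterSums F ℂ-commutativeRing
  open ≈-Reasoning ℂ-ring.setoid

  N₀′-by-characters :
    (P : Polynomial 2) (Q : Polynomial 3) (ψ : AdditiveCharacter) → Nontrivial ψ →
    ∀ r → length (P₀-roots P) ≡ r → {G : Carrier → ℂ → ℂ} →
    (∀ γ w → G γ w ≈ᶜ sumOver elements× (λ s → sumOver elements (λ β →
       AdditiveCharacter.χ ψ (s * eval Q (0# ∷ β ∷ γ ∷ [])))) ⊕ w) →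
    ℕ⇒ℂ (N₀′ P Q) ≈ᶜ ℕ⇒ℂ r +ᶜ 1/order *ᶜ foldr G (ℚ⇒ℂ 0ℚ) (P₀-roots P)
  N₀′-by-characters P Q ψ nontrivial r ≡.refl {G} G≈T =
    ≋⇒≈ᶜ (ℕ⇒ℂ (N₀′ P Q)) (ℕ⇒ℂ r +ᶜ 1/order *ᶜ foldr G (ℚ⇒ℂ 0ℚ) (P₀-roots P)) (begin
      ℕ⇒ℂ (N₀′ P Q)
        ≈⟨ ℕ⇒ℂ≋×1 (N₀′ P Q) ⟩
      N₀′ P Q × ℚ⇒ℂ 1ℚ
        ≈⟨ pairs-by-characters χ χ-cong χ-homo χ-0 vanishing 1/order
             (ℚ⇒ℂ-1/n⊗n≋1 q {{order-nonZero}}) (P₀-root? P) (λ β γ → eval Q (0# ∷ β ∷ γ ∷ [])) ⟩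
      r × ℚ⇒ℂ 1ℚ ⊕ 1/order ⊗ sumOver (P₀-roots P) T
        ≈⟨ ℂ-ring.+-congʳ (ℕ⇒ℂ≋×1 r) ⟨
      ℕ⇒ℂ r ⊕ 1/order ⊗ sumOver (P₀-roots P) T
        ≈⟨ ℂ-ring.+-congˡ (ℂ-ring.*-congˡ (foldr≋sumOver (P₀-roots P) T G≈T)) ⟨
      ℕ⇒ℂ r ⊕ 1/order ⊗ foldr G (ℚ⇒ℂ 0ℚ) (P₀-roots P)
        ≡⟨ ≡.cong (ℕ⇒ℂ r ⊕_) (⊗≡*ᶜ 1/order (foldr G (ℚ⇒ℂ 0ℚ) (P₀-roots P))) ⟩
      ℕ⇒ℂ r ⊕ 1/order *ᶜ foldr G (ℚ⇒ℂ 0ℚ) (P₀-roots P)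
        ≡⟨ ⊕≡+ᶜ (ℕ⇒ℂ r) (1/order *ᶜ foldr G (ℚ⇒ℂ 0ℚ) (P₀-roots P)) ⟩
      ℕ⇒ℂ r +ᶜ 1/order *ᶜ foldr G (ℚ⇒ℂ 0ℚ) (P₀-roots P) ∎)
    where
    open AdditiveCharacter ψ
    open IsMonoidHomomorphism isHomomorphism

    T : Carrier → ℂ
    T γ = sumOver elements× (λ s → sumOver elements (λ β → χ (s * eval Q (0# ∷ β ∷ γ ∷ []))))

    χ-cong : ∀ {x y} → x ≈ y → χ x ≋ χ y
    χ-cong {x} {y} x≈y = ≈ᶜ⇒≋ (χ x) (χ y) (⟦⟧-cong x≈y)

    χ-homo : ∀ x y → χ (x + y) ≋ χ x ⊗ χ y
    χ-homo x y = ≡.subst (χ (x + y) ≋_) (≡.sym (⊗≡*ᶜ (χ x) (χ y)))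
      (≈ᶜ⇒≋ (χ (x + y)) (χ x *ᶜ χ y) (homo x y))

    χ-0 : χ 0# ≋ ℚ⇒ℂ 1ℚ
    χ-0 = ≈ᶜ⇒≋ (χ 0#) (ℚ⇒ℂ 1ℚ) ε-homo

    vanishing : ∀ {y} → ¬ y ≈ 0# → characterSum χ χ-cong χ-homo χ-0 y ≋ ℚ⇒ℂ 0ℚ
    vanishing {y} y≉0 = common-eigenvector≋0 χ (characterSum χ χ-cong χ-homo χ-0 y) nontrivial
      (characterSum-invariant χ χ-cong χ-homo χ-0 {y} y≉0)

-- The type of proof is read off from theorem4p12 and not written out, since Agda
-- only compares two such nested sums quickly if they are syntactically equal.
proof : ∀ {c ℓ : Level} (q : ℕ) (F : FiniteField c ℓ q) → _

theorem4p12 : ∀ {c ℓ : Level} (q : ℕ) (F : FiniteField c ℓ q) →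
    let open FiniteField F
        open OverFiniteField F
    in
    (P : Polynomial 2) → MonicIn 1F P →
    (dP : ℕ) → HasDegreeIn 1F P dP → 2 ≤ dP →
    (Q : Polynomial 3) → MonicIn 1F Q →
    (dQ : ℕ) → HasDegreeIn 1F Q dQ → 2 ≤ dQ →
    (χ₁ : AdditiveCharacter) → Nontrivial χ₁ →
    (r : ℕ) → length (P₀-roots P) ≡ r →
    ℕ⇒ℂ (N₀′ P Q) ≈ᶜ
      ℕ⇒ℂ r +ᶜ 1/order *ᶜ
        ∑ (P₀-roots P) (λ γ →
          ∑ elements× (λ s →
            ∑ elements (λ β →
              AdditiveCharacter.χ χ₁ (s * eval Q (0# ∷ β ∷ γ ∷ [])))))
theorem4p12 q F = proof q F

proof q F P _ _ _ _ Q _ _ _ _ χ₁ nontrivial r #roots≡r =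
  N₀′-by-characters F P Q χ₁ nontrivial r #roots≡r (λ γ →
    foldr+ᶜ≈sumOver⊕ elements× (λ s → sumOver elements (λ β → χ (u s β γ))) (λ s →
      foldr+ᶜ≈sumOver⊕ elements (λ β → χ (u s β γ)) (λ β w →
        ≋⇒≈ᶜ (χ (u s β γ) +ᶜ w) (χ (u s β γ) ⊕ w)
          (ℂ-ring.reflexive (≡.sym (⊕≡+ᶜ (χ (u s β γ)) w))))))
  where
  open FiniteField F using (Carrier; 0#; _*_; elements)
  open OverFiniteField F
  open AdditiveCharacter χ₁ using (χ)
  open Summation ℂ-commutativeRing using (sumOver)

  u : Carrier → Carrier → Carrier → Carrier
  u s β γ = s * eval Q (0# ∷ β ∷ γ ∷ [])
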